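{- On HDAs over $\Sigma$, ${\underline{\leftrightarrow}_{qhp}}\subsetneq{\underline{\leftrightarrow}_{shp}}$. In fact, even ${\underline{\leftrightarrow}_{qhp}}\not\supseteq{\underline{\leftrightarrow}_{\{\sqsubseteq,\sqsupseteq,\hookleftarrow\}}}$, i.e. there are HDAs that are $\{\sqsubseteq,\sqsupseteq,\hookleftarrow\}$-bisimilar but not qhp-bisimilar.
   Context: HDAs. $\Sigma$ is a fixed set of actions, containing pairwise distinct actions $a,b,c,d$. A conclist is $U=(n,\lambda)$ with $n\in\mathbb N$ and $\lambda:\{1<\dots<n\}\to\Sigma$. The category $\square$ has conclists as objects; a morphism $(m,\lambda)\to(n,\mu)$ is a pair $(f,\varepsilon)$ with $f:\{1,\dots,m\}\to\{1,\dots,n\}$ injective, order- and label-preserving, and $\varepsilon:\{1,\dots,n\}\to\{0,*,1\}$ with $\varepsilon^{ -1}(*)=\mathrm{im} f$; composition is $(g,\zeta)\circ(f,\varepsilon)=(g\circ f,\eta)$ with $\eta(g(t))=\varepsilon(t)$ and $\eta(u)=\zeta(u)$ for $u\notin\mathrm{im}\,g$. For $1\le i\le n$, $k\in\{0,1\}$, the coface map $d_i^k:U\to V$ ($V$ of dimension $n$, $U$ of dimension $n-1$) has $f$ omitting position $i$, $\varepsilon(i)=k$, and $\varepsilon(j)=*$ for $j\ne i$. A precubical set is a functor $X:\square^{op}\to\mathbf{Set}$; elements of $X[U]$, $U=(n,\lambda)$, are $n$-dimensional cells, and $\delta_i^k:=X[d_i^k]$. An HDA is a pair $(X,i)$ of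 a precubical set and an initial $0$-dimensional cell $i$. Paths. A path of an HDA $\mathcal X$ is a sequence $\alpha=(x_0,\varphi_1,x_1,\dots,\varphi_n,x_n)$ ($n\ge 0$) with $x_0$ the initial cell, $x_j\in X[U_j]$, where for each $j$ either $\varphi_j=d^0_{i_j}:U_{j-1}\to U_j$ with $x_{j-1}=\delta^0_{i_j}(x_j)$ (up-step, starting an event) or $\varphi_j=d^1_{i_j}:U_j\to U_{j-1}$ with $x_j=\delta^1_{i_j}(x_{j-1})$ (down-step, ending an event). $\alpha\hookrightarrow\alpha'$ means $\alpha$ is a prefix of $\alpha'$. $\alpha\leftrightarrows^\ell\beta$ ($\ell$-similarity): one of $\alpha,\beta$ is obtained from the other by replacing, around the cell $x_\ell$, $(d_i^0,x_\ell,d_j^0)$ by $(d_{j-1}^0,x'_\ell,d_i^0)$, or $(d_j^1,x_\ell,d_i^1)$ by $(d_i^1,x'_\ell,d_{j-1}^1)$, for some $i<j$ and some cell $x'_\ell$. $\alpha\sqsubseteq^\ell\beta$ ($\beta$ subsumes $\alpha$ at $\ell$): $\alpha$ is obtained from $\beta$ by replacing, around $x_\ell$, $(d_i^0,x_\ell,d_j^1)$ by $(d_{j-1}^1,x'_\ell,d_i^0)$, or $(d_j^0,x_\ell,d_i^1)$ by $(d_i^1,x'_\ell,d_{j-1}^0)$, for some $i<j$. ST-traces. Given a down-step at position $p$ of a path, move it to the left: as long as the step directly before it is a down-step, or an up-step whose index differs from the current index of the moving down-step, there is a unique replacement moving it one position left: for some $i<j$ and cells $x,x'$, it replaces $(d_j^1,x,d_i^1)$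 by $(d_i^1,x',d_{j-1}^1)$ or conversely (if the step directly before is a down-step), or it replaces $(d_i^0,x,d_j^1)$ by $(d_{j-1}^1,x',d_i^0)$ or $(d_j^0,x,d_i^1)$ by $(d_i^1,x',d_{j-1}^0)$ (if the step directly before is an up-step). This stops when the step directly before it, at position $k$, is an up-step with the same index; put $\mathrm{start}(p)=k$. $\mathsf{ST}(\alpha)$ is the sequence whose $j$-th entry is $a^+$ if $\varphi_j$ is an up-step starting an event labelled $a$ (the label of the $i_j$-th event of $U_j$), and $a^{\mathrm{start}(j)}$ if $\varphi_j$ is a down-step ending an event labelled $a$ (the label of the $i_j$-th event of $U_{j-1}$). $I$-bisimulations. For $I\subseteq\{\sqsubseteq,\sqsupseteq,\leftrightarrows,\hookleftarrow\}$, an $I$-bisimulation between HDAs $\mathcal Y,\mathcal Z$ is a relation $\mathfrak R$ between paths of $\mathcal Y$ and of $\mathcal Z$ satisfying the following clauses, each also with the roles of $\mathcal Y$ and $\mathcal Z$ exchanged: (1) the length-$0$ paths of $\mathcal Y$ and $\mathcal Z$ are related; (2) if $(\alpha,\beta)\in\mathfrak R$ then $\mathsf{ST}(\alpha)=\mathsf{ST}(\beta)$; (3) if $(\alpha,\beta)\in\mathfrak R$ and $\alpha\hookrightarrow\alpha'$, there is $\beta'$ with $\beta\hookrightarrow\beta'$ and $(\alpha',\beta')\in\mathfrak R$; and those of the following whose symbol lies in $I$: ($\sqsubseteq$) if $(\alpha,\beta)\in\mathfrak R$ and $\alpha\sqsubseteq^\ell\alpha'$, there is $\beta'$ with $\beta\sqsubseteq^\ell\beta'$,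 $(\alpha',\beta')\in\mathfrak R$; ($\sqsupseteq$) the same with $\alpha'\sqsubseteq^\ell\alpha$ and $\beta'\sqsubseteq^\ell\beta$; ($\leftrightarrows$) the same with $\alpha'\leftrightarrows^\ell\alpha$ and $\beta'\leftrightarrows^\ell\beta$; ($\hookleftarrow$) the same with $\alpha'\hookrightarrow\alpha$ and $\beta'\hookrightarrow\beta$. $\mathcal Y,\mathcal Z$ are $I$-bisimilar, $\mathcal Y\,\underline{\leftrightarrow}_I\,\mathcal Z$, if an $I$-bisimulation between them exists. Names: shp is $I=\{\sqsubseteq\}$; qhp is $I=\{\sqsubseteq,\leftrightarrows\}$. -}

module Defs where

open import Data.Fin using (Fin; zero; suc; toℕ; punchIn; punchOut; _≟_)
import Data.Fin as Fin
open import Data.Fin.Patterns using (0F; 1F)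
open import Data.Fin.Properties using (any?; punchIn-injective; punchIn-mono-≤; punchInᵢ≢i; punchIn-punchOut)
open import Data.List using (List; []; _∷ʳ_)
open import Data.Maybe using (Maybe; just; nothing)
open import Data.Nat using (ℕ; suc; pred; _<_)
open import Data.Product using (Σ; ∃; ∃-syntax; ∃₂; _×_; _,_; proj₁; proj₂)
open import Data.Sum using (_⊎_)
open import Data.Vec using (Vec; []; _∷_; lookup; removeAt)
open import Function using (id; _∘_)
open import Function.Bundles using (_⇔_; mk⇔; Equivalence)
open import Function.Definitions using (Injective)
open import Level using (0ℓ)
open import Relation.Binary.Core using (Rel)
open import Relation.Binary.PropositionalEquality using (_≡_; _≗_; refl; sym; trans; cong)
open import Relation.Nullary using (yes; no; contradiction)
open import Relation.Unary using (Pred; _∈_; ｛_｝; _∪_)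

------------------------------------------------------------------------
-- The category □

-- The labelling {1 < … < n} → Act is a vector rather than a function, so
-- that equality of objects is extensional.  Positions are counted from 0.
Conclist : Set → Set
Conclist Act = ∃ (Vec Act)

-- ε takes values in {0, *, 1}: `just 0F` is 0, `just 1F` is 1, and ∗ is *.
pattern ∗ = nothing

record Hom {Act : Set} (U V : Conclist Act) : Set where
  field
    f         : Fin (proj₁ U) → Fin (proj₁ V)
    ε         : Fin (proj₁ V) → Maybe (Fin 2)
    injective : Injective _≡_ _≡_ f
    monotone  : ∀ {s t} → s Fin.≤ t → f s Fin.≤ f t
    labels    : ∀ t → lookup (proj₂ V) (f t) ≡ lookup (proj₂ U) t
    star      : ∀ u → ε u ≡ ∗ ⇔ (∃[ t ] f t ≡ u)

module _ {Act : Set} where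

  open Hom

  infix 4 _≈_
  _≈_ : {U V : Conclist Act} → Rel (Hom U V) 0ℓ
  φ ≈ ψ = f φ ≗ f ψ × ε φ ≗ ε ψ

  idHom : {U : Conclist Act} → Hom U U
  idHom .f         = id
  idHom .ε _       = ∗
  idHom .injective = id
  idHom .monotone  = id
  idHom .labels _  = refl
  idHom .star u    = mk⇔ (λ _ → u , refl) (λ _ → refl)

  infixr 9 _⊚_
  _⊚_ : {U V W : Conclist Act} → Hom V W → Hom U V → Hom U W
  (ψ ⊚ φ) .f = f ψ ∘ f φ
  (ψ ⊚ φ) .ε u with any? (λ t → f ψ t ≟ u)
  ... | yes (t , _) = ε φ t
  ... | no  _       = ε ψ u
  (ψ ⊚ φ) .injective  = injective φ ∘ injective ψ
  (ψ ⊚ φ) .monotone   = monotone ψ ∘ monotone φ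
  (ψ ⊚ φ) .labels t   = trans (labels ψ (f φ t)) (labels φ t)
  (ψ ⊚ φ) .star u with any? (λ t → f ψ t ≟ u)
  ... | yes (t , refl) = mk⇔
    (λ e → let (s , p) = Equivalence.to (star φ t) e in s , cong (f ψ) p)
    (λ (s , p) → Equivalence.from (star φ t) (s , injective ψ p))
  ... | no  u∉im       = mk⇔
    (λ e → contradiction (Equivalence.to (star ψ u) e) u∉im)
    (λ (s , p) → contradiction (f φ s , p) u∉im)

  lookup-punchIn : ∀ {n} (V : Vec Act (suc n)) i t →
                   lookup V (punchIn i t) ≡ lookup (removeAt V i) t
  lookup-punchIn (_ ∷ _)     zero    _       = refl
  lookup-punchIn (_ ∷ _ ∷ _) (suc _) zero    = refl
  lookup-punchIn (_ ∷ y ∷ V) (suc i) (suc t) = lookup-punchIn (y ∷ V) i t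

  coface : ∀ {n} (k : Fin 2) {V : Vec Act (suc n)} (i : Fin (suc n)) →
           Hom (n , removeAt V i) (suc n , V)
  coface k i .f = punchIn i
  coface k i .ε j with i ≟ j
  ... | yes _ = just k
  ... | no  _ = ∗
  coface k i .injective    = punchIn-injective i _ _
  coface k i .monotone     = punchIn-mono-≤ i _ _
  coface k {V} i .labels t = lookup-punchIn V i t
  coface k i .star j with i ≟ j
  ... | yes refl = mk⇔ (λ ()) (λ (t , p) → contradiction p (punchInᵢ≢i i t))
  ... | no  i≢j  = mk⇔ (λ _ → punchOut i≢j , punchIn-punchOut i≢j) (λ _ → refl)

------------------------------------------------------------------------
-- Precubical sets and HDAs

-- A functor □ᵒᵖ → Set.  Equality of morphisms is the pointwise _≈_, which
-- `act` must respect since function extensionality is unavailable.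
record PrecubicalSet (Act : Set) : Set₁ where
  field
    Ob       : Conclist Act → Set
    act      : ∀ {U V} → Hom U V → Ob V → Ob U
    act-cong : ∀ {U V} {φ ψ : Hom U V} → φ ≈ ψ → act φ ≗ act ψ
    act-id   : ∀ {U} → act (idHom {U = U}) ≗ id
    act-∘    : ∀ {U V W} (ψ : Hom V W) (φ : Hom U V) →
               act (ψ ⊚ φ) ≗ act φ ∘ act ψ

  Cell : Set
  Cell = Σ (Conclist Act) Ob

  δ : ∀ {n} (k : Fin 2) {V : Vec Act (suc n)} (i : Fin (suc n)) →
      Ob (suc n , V) → Ob (n , removeAt V i)
  δ k i = act (coface k i)

record HDA (Act : Set) : Set₁ where
  field
    cells   : PrecubicalSet Act
    initial : PrecubicalSet.Ob cells (0 , [])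

  open PrecubicalSet cells public

------------------------------------------------------------------------
-- Paths

module _ {Act : Set} (X : HDA Act) where

  open HDA X

  -- The equations are between cells in the total type `Cell`, so they also
  -- state that the conclist of the face is the required one.
  data Step : Cell → Cell → Set where
    up   : ∀ {n U V} {x : Ob (n , U)} {y : Ob (suc n , V)} (i : Fin (suc n)) →
           _≡_ {A = Cell} (_ , x) (_ , δ 0F i y) →
           Step (_ , x) (_ , y)
    down : ∀ {n U V} {x : Ob (suc n , U)} {y : Ob (n , V)} (i : Fin (suc n)) →
           _≡_ {A = Cell} (_ , y) (_ , δ 1F i x) →
           Step (_ , x) (_ , y)

  infixl 5 _▷_
  data Path : Cell → Set where
    []  : Path (_ , initial)
    _▷_ : ∀ {x y} → Path x → Step x y → Path y

module _ {Act : Set} {X : HDA Act} where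

  open HDA X

  length : ∀ {x} → Path X x → ℕ
  length []      = 0
  length (α ▷ _) = suc (length α)

  infix 4 _↪_
  data _↪_ {x} (α : Path X x) : ∀ {y} → Path X y → Set where
    ↪-refl : α ↪ α
    ↪-step : ∀ {y z} {α′ : Path X y} {s : Step X y z} → α ↪ α′ → α ↪ α′ ▷ s

------------------------------------------------------------------------
-- Similarity and subsumption

-- The morphism φ of a step, as a superscript and an index: between given
-- conclists it is determined by these.
data Code : Set where
  d⁰ d¹ : ℕ → Code

-- `Sim s₁ s₂ t₁ t₂` and `Sub s₁ s₂ t₁ t₂` are the allowed replacements of
-- (s₁ , x , s₂) by (t₁ , x′ , t₂).
data Sim : Code → Code → Code → Code → Set where
  sim⁰⁰ : ∀ {i j} → i < j → Sim (d⁰ i) (d⁰ j) (d⁰ (pred j)) (d⁰ i)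
  sim¹¹ : ∀ {i j} → i < j → Sim (d¹ j) (d¹ i) (d¹ i) (d¹ (pred j))

data Sub : Code → Code → Code → Code → Set where
  sub⁰¹ : ∀ {i j} → i < j → Sub (d⁰ i) (d¹ j) (d¹ (pred j)) (d⁰ i)
  sub¹⁰ : ∀ {i j} → i < j → Sub (d⁰ j) (d¹ i) (d¹ i) (d⁰ (pred j))

module _ {Act : Set} {X : HDA Act} where

  open HDA X

  code : ∀ {x y} → Step X x y → Code
  code (up   i _) = d⁰ (toℕ i)
  code (down i _) = d¹ (toℕ i)

  -- `Replace S ℓ α β`: β arises from α by replacing, according to S, the two
  -- steps around the ℓ-th cell (and that cell itself).
  data Replace (S : Code → Code → Code → Code → Set) :
               ℕ → ∀ {x} → Path X x → Path X x → Set where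
    here  : ∀ {w x x′ y} {γ : Path X w}
            {s₁ : Step X w x}  {s₂ : Step X x y}
            {t₁ : Step X w x′} {t₂ : Step X x′ y} →
            S (code s₁) (code s₂) (code t₁) (code t₂) →
            Replace S (suc (length γ)) (γ ▷ s₁ ▷ s₂) (γ ▷ t₁ ▷ t₂)
    there : ∀ {ℓ x y} {α β : Path X x} {s : Step X x y} →
            Replace S ℓ α β → Replace S ℓ (α ▷ s) (β ▷ s)

  infix 4 _⇆[_]_ _⊑[_]_

  _⇆[_]_ : ∀ {x} → Path X x → ℕ → Path X x → Set
  α ⇆[ ℓ ] β = Replace Sim ℓ α β ⊎ Replace Sim ℓ β α

  _⊑[_]_ : ∀ {x} → Path X x → ℕ → Path X x → Set
  α ⊑[ ℓ ] β = Replace Sub ℓ β α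

------------------------------------------------------------------------
-- ST-traces

data Entry (Act : Set) : Set where
  _⁺   : Act → Entry Act
  _at_ : Act → ℕ → Entry Act      -- a at k  is  aᵏ

module _ {Act : Set} {X : HDA Act} where

  open HDA X

  -- `start γ c` is start(p) for a down-step d¹_c standing directly after γ;
  -- while the down-step moves left, γ is the part of the path before it and
  -- c is its current index.  The step it is exchanged with ends up behind it
  -- and plays no further role.  The exchange rules give the new index of the
  -- moving step:
  --   (d⁰_p , d¹_c):  c − 1 if p < c,  c if c < p      (punchOut);
  --   (d¹_p , d¹_c):  c if c < p,  c + 1 if p ≤ c      (punchIn p c).
  start : ∀ {n U} {x : Ob (n , U)} → Path X (_ , x) → Fin n → ℕ
  start []             ()
  start (γ ▷ up p _)   c with p ≟ c
  ... | yes _   = suc (length γ)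
  ... | no  p≢c = start γ (punchOut p≢c)
  start (γ ▷ down p _) c = start γ (punchIn p c)

  ST : ∀ {x} → Path X x → List (Entry Act)
  ST []                      = []
  ST (γ ▷ up   {V = V} i _)  = ST γ ∷ʳ (lookup V i ⁺)
  ST (γ ▷ down {U = U} i _)  = ST γ ∷ʳ (lookup U i at start γ i)

------------------------------------------------------------------------
-- I-bisimulations

data Symbol : Set where
  ⊑ ⊒ ⇆ ↩ : Symbol

module _ {Act : Set} where

  PathRel : HDA Act → HDA Act → Set₁
  PathRel Y Z = ∀ {y z} → Path Y y → Path Z z → Set

  record IsSimulation (I : Pred Symbol 0ℓ) {Y Z : HDA Act} (R : PathRel Y Z) : Set where
    field
      empty  : R [] []
      trace  : ∀ {y z} {α : Path Y y} {β : Path Z z} → R α β → ST α ≡ ST β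
      extend : ∀ {y z} {α : Path Y y} {β : Path Z z} → R α β →
               ∀ {y′} {α′ : Path Y y′} → α ↪ α′ →
               ∃₂ λ z′ (β′ : Path Z z′) → β ↪ β′ × R α′ β′
      sim-⊑  : ⊑ ∈ I → ∀ {y z} {α : Path Y y} {β : Path Z z} → R α β →
               ∀ {ℓ} {α′ : Path Y y} → α ⊑[ ℓ ] α′ →
               ∃[ β′ ] β ⊑[ ℓ ] β′ × R α′ β′
      sim-⊒  : ⊒ ∈ I → ∀ {y z} {α : Path Y y} {β : Path Z z} → R α β →
               ∀ {ℓ} {α′ : Path Y y} → α′ ⊑[ ℓ ] α →
               ∃[ β′ ] β′ ⊑[ ℓ ] β × R α′ β′
      sim-⇆  : ⇆ ∈ I → ∀ {y z} {α : Path Y y} {β : Path Z z} → R α β →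
               ∀ {ℓ} {α′ : Path Y y} → α′ ⇆[ ℓ ] α →
               ∃[ β′ ] β′ ⇆[ ℓ ] β × R α′ β′
      sim-↩  : ↩ ∈ I → ∀ {y z} {α : Path Y y} {β : Path Z z} → R α β →
               ∀ {y′} {α′ : Path Y y′} → α′ ↪ α →
               ∃₂ λ z′ (β′ : Path Z z′) → β′ ↪ β × R α′ β′

  IsBisimulation : Pred Symbol 0ℓ → {Y Z : HDA Act} → PathRel Y Z → Set
  IsBisimulation I {Y} {Z} R =
    IsSimulation I {Y} {Z} R × IsSimulation I {Z} {Y} (λ β α → R α β)

  Bisimilar : Pred Symbol 0ℓ → Rel (HDA Act) _
  Bisimilar I Y Z = Σ (PathRel Y Z) λ R → IsBisimulation I {Y} {Z} R

shp qhp : Pred Symbol 0ℓ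
shp = ｛ ⊑ ｝
qhp = ｛ ⊑ ｝ ∪ ｛ ⇆ ｝

{-# OPTIONS --safe #-}

-- The events a and b are concurrent, and afterwards c can be performed in one
-- of two modes.  In Y, mode `true` of c may start once a or b is done, so it is
-- independent of whichever of them ends last, while mode `false` needs both to
-- be done.  In Z, mode `false` needs a to be done and mode `true` needs b.
-- Along a path on which the truth values of "a is done" and "b is done" stay
-- comparable in a fixed direction, ∧ and ∨ are the two projections in some
-- order, so Y and Z agree there up to a renaming of the modes.  Subsumption
-- never changes which of a and b ends first, so relating the paths that agree up
-- to such a renaming is a {⊑, ⊒, ↩}-bisimulation.  Similarity does exchange the
-- two ends: after it, one and the same c (mode `true` in Y) overlaps first with
-- b and then with a, which no c of Z does.
module Submission where

open import Defs
open import Data.Bool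
  using (Bool; true; false; T; not; _∧_; _∨_; _xor_; if_then_else_; _≤_; f≤t; b≤b)
open import Data.Bool.Properties
  using (T?; ≤-reflexive; ≤-antisym; ≤-maximum; ≤-minimum; not-involutive)
open import Data.Empty using (⊥)
open import Data.Fin using (Fin; suc; _≟_; punchIn; punchOut)
open import Data.Fin.Patterns using (0F; 1F; 2F)
open import Data.Fin.Properties using (any?; toℕ-injective)
open import Data.List as List using ([]; _∷_; _∷ʳ_)
open import Data.List.Properties using (length-++; ∷ʳ-injectiveˡ; ∷ʳ-injectiveʳ)
open import Data.List.Relation.Unary.All using (_∷_)
open import Data.List.Relation.Unary.AllPairs using (_∷_)
open import Data.List.Relation.Unary.Unique.Propositional using (Unique)
open import Data.Maybe using (Maybe; just)
open import Data.Nat using (suc; z≤n; s≤s; _<_)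
open import Data.Nat.Properties using (+-comm; suc-injective; <-irrefl; ≤-refl; m<n⇒m<1+n)
open import Data.Product using (∃; ∃₂; ∃-syntax; _×_; _,_; proj₁; proj₂)
open import Data.Sum using (_⊎_; inj₁; inj₂)
open import Data.Unit using (tt)
open import Data.Vec using (Vec; []; _∷_; lookup; tabulate; replicate; removeAt)
open import Data.Vec.Relation.Unary.All using ([]; _∷_)
open import Data.Vec.Relation.Unary.AllPairs using ([]; _∷_)
open import Data.Vec.Relation.Unary.Unique.Propositional.Properties using (lookup-injective)
open import Data.Vec.Properties using (lookup∘tabulate; tabulate∘lookup; tabulate-cong)
open import Function using (id; _∘_)
open import Function.Bundles using (Equivalence)
open import Function.Definitions using (Injective)
open import Level using (0ℓ)
open import Relation.Binary.Core using (_⇒_)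
open import Relation.Binary.PropositionalEquality
  using (_≡_; _≢_; _≗_; refl; sym; trans; cong; cong₂; subst; subst₂)
open import Relation.Nullary using (¬_; yes; no; contradiction; recompute)
open import Relation.Unary using (Pred; _⊆_; ｛_｝; _∪_)

-- Phases of events and the effect of faces on them

-- Every event has two modes, the Booleans; they only matter for c.
data Phase : Set where
  idle   : Phase
  active : Bool → Phase
  done   : Bool → Phase

isActive isDone : Phase → Bool
isActive (active _) = true
isActive _          = false
isDone (done _) = true
isDone _        = false

-- A lower face takes back the start of an active event, an upper face carries out its end.
collapse : Maybe (Fin 2) → Phase → Phase
collapse (just 0F) (active _) = idle
collapse (just 1F) (active m) = done m
collapse _         w          = w

collapse-∗ : ∀ w → collapse ∗ w ≡ w
collapse-∗ idle       = refl
collapse-∗ (active _) = refl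
collapse-∗ (done _)   = refl

isDone-collapse : ∀ e w → isDone w ≤ isDone (collapse e w)
isDone-collapse _         idle       = ≤-minimum _
isDone-collapse _         (active _) = ≤-minimum _
isDone-collapse ∗         (done _)   = b≤b
isDone-collapse (just 0F) (done _)   = b≤b
isDone-collapse (just 1F) (done _)   = b≤b

isDone-collapse⁰ : ∀ w → isDone (collapse (just 0F) w) ≡ isDone w
isDone-collapse⁰ idle       = refl
isDone-collapse⁰ (active _) = refl
isDone-collapse⁰ (done _)   = refl

collapse-active : ∀ k {w m} → collapse (just k) w ≢ active m
collapse-active 0F {idle}     ()
collapse-active 0F {active _} ()
collapse-active 0F {done _}   ()
collapse-active 1F {idle}     ()
collapse-active 1F {active _} ()
collapse-active 1F {done _}   ()

-- Precubical sets cut out by predicates on phase vectors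

module _ {n N} (es : Vec (Fin N) n) where

  -- Extends ε from the positions of a cell to all events; the default ∗ leaves unlisted events
  -- alone.
  pull : (Fin n → Maybe (Fin 2)) → Fin N → Maybe (Fin 2)
  pull ε u with any? (λ t → lookup es t ≟ u)
  ... | yes (t , _) = ε t
  ... | no  _       = ∗

  pull-cong : ∀ {ε ε′} → ε ≗ ε′ → pull ε ≗ pull ε′
  pull-cong ε≗ u with any? (λ t → lookup es t ≟ u)
  ... | yes (t , _) = ε≗ t
  ... | no  _       = refl

  pull-lookup : Injective _≡_ _≡_ (lookup es) → ∀ ε t → pull ε (lookup es t) ≡ ε t
  pull-lookup inj ε t with any? (λ s → lookup es s ≟ lookup es t)
  ... | yes (s , eq) = cong ε (inj eq)
  ... | no  t∉       = contradiction (t , refl) t∉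

  pull-∉ : ∀ ε {u} → ¬ (∃[ t ] lookup es t ≡ u) → pull ε u ≡ ∗
  pull-∉ ε {u} u∉ with any? (λ t → lookup es t ≟ u)
  ... | yes u∈ = contradiction u∈ u∉
  ... | no  _  = refl

  pull-elim : ∀ (Q : Maybe (Fin 2) → Set) {ε} → Q ∗ → (∀ t → Q (ε t)) → ∀ u → Q (pull ε u)
  pull-elim Q q∗ qε u with any? (λ t → lookup es t ≟ u)
  ... | yes (t , _) = qε t
  ... | no  _       = q∗

-- Stability under faces. Letting `e` be any assignment frees the condition from lists of events.
Closed : ∀ {N} → (Vec Phase N → Bool) → Set
Closed {N} P = ∀ ps (e : Fin N → Maybe (Fin 2)) →
               T (P ps) → T (P (tabulate λ u → collapse (e u) (lookup ps u)))

-- The proofs are irrelevant, so that a face is determined by its events and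
-- phases.  The order of `events` is free: each square occurs in both orders.
-- An event may also be active without being listed; the faces where this
-- happens are not reachable from the initial cell.
module _ {Act : Set} {N} (L : Vec Act N) (P : Vec Phase N → Bool) where

  record Face (U : Conclist Act) : Set where
    constructor face
    field
      events     : Vec (Fin N) (proj₁ U)
      phases     : Vec Phase N
      .injective : Injective _≡_ _≡_ (lookup events)
      .labels    : ∀ t → lookup L (lookup events t) ≡ lookup (proj₂ U) t
      .active-at : ∀ t → T (isActive (lookup phases (lookup events t)))
      .allowed   : T (P phases)

open Face

module _ {Act : Set} {N} {L : Vec Act N} {P : Vec Phase N → Bool} where

  cellPhases : ∃ (Face L P) → Vec Phase N
  cellPhases (_ , F) = phases F

  face-≡ : ∀ {U} {F G : Face L P U} → events F ≡ events G → phases F ≡ phases G → F ≡ G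
  face-≡ refl refl = refl

  module _ (closed : Closed P) {U V : Conclist Act} where

    restrict : Hom U V → Face L P V → Face L P U
    restrict φ F .events = tabulate (lookup (events F) ∘ Hom.f φ)
    restrict φ F .phases =
      tabulate λ u → collapse (pull (events F) (Hom.ε φ) u) (lookup (phases F) u)
    restrict φ (face es ps inj _ _ _) .injective {s} {t} eq = Hom.injective φ (inj
      (trans (sym (lookup∘tabulate _ s)) (trans eq (lookup∘tabulate _ t))))
    restrict φ (face es ps _ lab _ _) .labels t =
      trans (cong (lookup L) (lookup∘tabulate _ t)) (trans (lab (Hom.f φ t)) (Hom.labels φ t))
    -- An event listed in the face lies in the image of `f φ`, so `star` gives it the value ∗ and it
    -- stays active.
    restrict φ (face es ps inj _ act _) .active-at t
      rewrite lookup∘tabulate (lookup es ∘ Hom.f φ) t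
            | lookup∘tabulate (λ u → collapse (pull es (Hom.ε φ) u) (lookup ps u))
                              (lookup es (Hom.f φ t))
            | pull-lookup es inj (Hom.ε φ) (Hom.f φ t)
            | Equivalence.from (Hom.star φ (Hom.f φ t)) (t , refl)
            | collapse-∗ (lookup ps (lookup es (Hom.f φ t)))
            = act (Hom.f φ t)
    restrict φ (face es ps _ _ _ all) .allowed = closed ps (pull es (Hom.ε φ)) all

  complex : Closed P → PrecubicalSet Act
  complex closed .PrecubicalSet.Ob  = Face L P
  complex closed .PrecubicalSet.act = restrict closed
  complex closed .PrecubicalSet.act-cong {φ = φ} {ψ} (f≗ , ε≗) F = face-≡
    (tabulate-cong λ t → cong (lookup (events F)) (f≗ t))
    (tabulate-cong λ u → cong (λ e → collapse e (lookup (phases F) u)) (pull-cong (events F) ε≗ u))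
  complex closed .PrecubicalSet.act-id F = face-≡
    (tabulate∘lookup (events F))
    (trans (tabulate-cong λ u → trans (cong (λ e → collapse e (lookup (phases F) u))
                                            (pull-elim (events F) (_≡ ∗) refl (λ _ → refl) u))
                                      (collapse-∗ (lookup (phases F) u)))
           (tabulate∘lookup (phases F)))
  complex closed .PrecubicalSet.act-∘ ψ φ F@(face es ps inj _ _ _) = face-≡
    (tabulate-cong λ t → sym (lookup∘tabulate _ (Hom.f φ t)))
    (tabulate-cong λ u → trans (step u (lookup ps u))
       (cong (collapse _) (sym (lookup∘tabulate _ u))))
    where
    es′ = tabulate (lookup es ∘ Hom.f ψ)

    -- Injectivity is an irrelevant field; decidable equality of positions makes it usable in a
    -- relevant argument.
    inj-es : Injective _≡_ _≡_ (lookup es)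
    inj-es eq = recompute (_ ≟ _) (inj eq)

    inj-es′ : Injective _≡_ _≡_ (lookup es′)
    inj-es′ {s} {t} eq = Hom.injective ψ (inj-es
      (trans (sym (lookup∘tabulate _ s)) (trans eq (lookup∘tabulate _ t))))

    -- At most one of the two morphisms acts on each event: an unlisted event is left alone by both,
    -- an event kept by `ψ` is treated by `φ` only, and an event dropped by `ψ` is no longer listed
    -- when `φ` is applied.
    step : ∀ u w → collapse (pull es (Hom.ε (ψ ⊚ φ)) u) w ≡
                   collapse (pull es′ (Hom.ε φ) u) (collapse (pull es (Hom.ε ψ) u) w)
    step u w with any? (λ t → lookup es t ≟ u)
    ... | no  u∉
          rewrite pull-∉ es′ (Hom.ε φ) {u}
                    (λ (t , eq) → u∉ (Hom.f ψ t , trans (sym (lookup∘tabulate _ t)) eq))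
          = sym (collapse-∗ (collapse ∗ w))
    ... | yes (t , refl) with any? (λ s → Hom.f ψ s ≟ t)
    ...   | yes (s , refl)
            rewrite sym (lookup∘tabulate (lookup es ∘ Hom.f ψ) s)
                  | pull-lookup es′ inj-es′ (Hom.ε φ) s
                  | Equivalence.from (Hom.star ψ (Hom.f ψ s)) (s , refl)
                  | collapse-∗ w = refl
    ...   | no  t∉
            rewrite pull-∉ es′ (Hom.ε φ) {lookup es t}
                      (λ (s , eq) → t∉ (s , inj-es (trans (sym (lookup∘tabulate _ s)) eq)))
            = sym (collapse-∗ (collapse (Hom.ε ψ t) w))

-- How steps change phases

data IsUp : Code → Set where
  isUp : ∀ {i} → IsUp (d⁰ i)

data IsDown : Code → Set where
  isDown : ∀ {i} → IsDown (d¹ i)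

sub-shape : ∀ {c₁ c₂ c₃ c₄} → Sub c₁ c₂ c₃ c₄ → IsUp c₁ × IsDown c₂ × IsUp c₄
sub-shape (sub⁰¹ _) = isUp , isDown , isUp
sub-shape (sub¹⁰ _) = isUp , isDown , isUp

module _ {Act : Set} {N} (L : Vec Act N) {P : Vec Phase N → Bool}
         (closed : Closed P) (start-allowed : T (P (replicate N idle))) where

  complexHDA : HDA Act
  complexHDA .HDA.cells   = complex {L = L} closed
  complexHDA .HDA.initial = face [] (replicate N idle) (λ {}) (λ ()) (λ ()) start-allowed

  private
    X = complexHDA

  -- The coface map only takes the values ∗ and k. Which event it collapses does not matter for what
  -- follows.
  δ-phase : ∀ k {n V} (i : Fin (suc n)) (F : Face L P (suc n , V)) u →
            lookup (phases (HDA.δ X k i F)) u ≡ lookup (phases F) u ⊎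
            lookup (phases (HDA.δ X k i F)) u ≡ collapse (just k) (lookup (phases F) u)
  δ-phase k {V = V} i F u
    rewrite lookup∘tabulate
              (λ u → collapse (pull (events F) (Hom.ε (coface k {V} i)) u) (lookup (phases F) u)) u
    = pull-elim (events F) (λ e → collapse e w ≡ w ⊎ collapse e w ≡ collapse (just k) w)
        (inj₁ (collapse-∗ w)) cases u
    where
    w = lookup (phases F) u
    cases : ∀ t → collapse (Hom.ε (coface k {V} i) t) w ≡ w ⊎
                  collapse (Hom.ε (coface k {V} i) t) w ≡ collapse (just k) w
    cases t with i ≟ t
    ... | yes _ = inj₂ refl
    ... | no  _ = inj₁ (collapse-∗ w)

  up-isDone : ∀ {x y} (t : Step X x y) → IsUp (code {X = X} t) → ∀ u →
              isDone (lookup (cellPhases x) u) ≡ isDone (lookup (cellPhases y) u)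
  up-isDone (up {y = G} i refl) _ u with δ-phase 0F i G u
  ... | inj₁ eq = cong isDone eq
  ... | inj₂ eq = trans (cong isDone eq) (isDone-collapse⁰ _)
  up-isDone (down _ _) ()

  step-isDone : ∀ {x y} → Step X x y → ∀ u →
                isDone (lookup (cellPhases x) u) ≤ isDone (lookup (cellPhases y) u)
  step-isDone t@(up _ _) u = ≤-reflexive (up-isDone t isUp u)
  step-isDone (down {x = F} i refl) u with δ-phase 1F i F u
  ... | inj₁ eq = ≤-reflexive (cong isDone (sym eq))
  ... | inj₂ eq rewrite eq = isDone-collapse (just 1F) _

  -- Collapsing never produces an active phase, so an event active in a face was left untouched,
  -- mode included.
  δ-active : ∀ k {n V} (i : Fin (suc n)) (F : Face L P (suc n , V)) u {m} →
             lookup (phases (HDA.δ X k i F)) u ≡ active m → lookup (phases F) u ≡ active m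
  δ-active k i F u eq with δ-phase k i F u
  ... | inj₁ eq′ = trans (sym eq′) eq
  ... | inj₂ eq′ = contradiction (trans (sym eq′) eq) (collapse-active k)

-- Models given by a rule for the modes of c

-- `K m p q`: may c be performed in mode m, where p and q tell whether a and b
-- are done?
Rule : Set
Rule = Bool → Bool → Bool → Bool

guard : Rule → Phase → Bool → Bool → Bool
guard K idle       _ _ = true
guard K (active m) p q = K m p q
guard K (done m)   p q = K m p q

permits : Rule → Vec Phase 3 → Bool
permits K (x ∷ y ∷ z ∷ []) = guard K z (isDone x) (isDone y)

Monotone : Rule → Set
Monotone K = ∀ m {p p′ q q′} → p ≤ p′ → q ≤ q′ → T (K m p q) → T (K m p′ q′)

-- A face can only make more of a and b done, and it either keeps the mode of c or makes c idle,
-- when nothing is required.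
permits-closed : ∀ {K} → Monotone K → Closed (permits K)
permits-closed {K} mono (x ∷ y ∷ z ∷ []) e = go z (e 2F)
  where
  go : ∀ z e₂ → T (guard K z (isDone x) (isDone y)) →
       T (guard K (collapse e₂ z) (isDone (collapse (e 0F) x)) (isDone (collapse (e 1F) y)))
  keep = λ {m} → mono m {isDone x} {isDone (collapse (e 0F) x)}
                        {isDone y} {isDone (collapse (e 1F) y)}
                        (isDone-collapse (e 0F) x) (isDone-collapse (e 1F) y)

  go idle       e₂        _ = subst (λ z → T (guard K z _ _)) (sym (collapse-idle e₂)) tt
    where
    collapse-idle : ∀ e → collapse e idle ≡ idle
    collapse-idle ∗         = refl
    collapse-idle (just 0F) = refl
    collapse-idle (just 1F) = refl
  go (active _) ∗         = keep
  go (active _) (just 0F) = _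
  go (active _) (just 1F) = keep
  go (done _)   ∗         = keep
  go (done _)   (just 0F) = keep
  go (done _)   (just 1F) = keep

model : ∀ {Act} → Vec Act 3 → (K : Rule) → Monotone K → HDA Act
model L K mono = complexHDA L {permits K} (permits-closed mono) _

-- Codes and simulations in general

d⁰-injective : ∀ {i j} → d⁰ i ≡ d⁰ j → i ≡ j
d⁰-injective refl = refl

d¹-injective : ∀ {i j} → d¹ i ≡ d¹ j → i ≡ j
d¹-injective refl = refl

module _ {Act : Set} where

  IsSimulation-resp : ∀ {I Y Z} {R R′ : PathRel {Act} Y Z} →
    (∀ {y z} {α : Path Y y} {β : Path Z z} → R α β → R′ α β) →
    (∀ {y z} {α : Path Y y} {β : Path Z z} → R′ α β → R α β) →
    IsSimulation I R → IsSimulation I R′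
  IsSimulation-resp to from S = record
    { empty  = to S.empty
    ; trace  = λ r → S.trace (from r)
    ; extend = λ r p → let _ , β , q , r′ = S.extend (from r) p in _ , β , q , to r′
    ; sim-⊑  = λ i r p → let β , q , r′ = S.sim-⊑ i (from r) p in β , q , to r′
    ; sim-⊒  = λ i r p → let β , q , r′ = S.sim-⊒ i (from r) p in β , q , to r′
    ; sim-⇆  = λ i r p → let β , q , r′ = S.sim-⇆ i (from r) p in β , q , to r′
    ; sim-↩  = λ i r p → let _ , β , q , r′ = S.sim-↩ i (from r) p in _ , β , q , to r′
    }
    where module S = IsSimulation S

  -- Fewer symbols mean fewer clauses, so the same relation serves.
  Bisimilar-antitone : ∀ {I J : Pred Symbol 0ℓ} → I ⊆ J → ∀ {Y Z} →
                       Bisimilar {Act} J Y Z → Bisimilar I Y Z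
  Bisimilar-antitone {I} {J} I⊆J (R , S , S′) = R , weaken S , weaken S′
    where
    weaken : ∀ {Y Z} {R : PathRel Y Z} → IsSimulation J R → IsSimulation I R
    weaken S = record
      { empty  = S.empty
      ; trace  = S.trace
      ; extend = S.extend
      ; sim-⊑  = λ i → S.sim-⊑ (I⊆J i)
      ; sim-⊒  = λ i → S.sim-⊒ (I⊆J i)
      ; sim-⇆  = λ i → S.sim-⇆ (I⊆J i)
      ; sim-↩  = λ i → S.sim-↩ (I⊆J i)
      }
      where module S = IsSimulation S

-- Order of the ends of a and b, and renaming of the modes of c

Ordered : Bool → Bool → Bool → Set
Ordered false p q = p ≤ q
Ordered true  p q = q ≤ p

ordered-diagonal : ∀ s {p} → Ordered s p p
ordered-diagonal false = b≤b
ordered-diagonal true  = b≤b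

-- Truth values only grow, so the direction can break only when both were still false; then the
-- opposite direction holds.
ordered-step : ∀ s {p q p′ q′} → p ≤ p′ → q ≤ q′ → Ordered s p q →
               Ordered s p′ q′ ⊎ (p ≡ false × q ≡ false × Ordered (not s) p′ q′)
ordered-step false {p′ = true} {false} f≤t b≤b _  = inj₂ (refl , refl , f≤t)
ordered-step false {p′ = true} {false} b≤b b≤b ()
ordered-step false {p′ = true} {true}  _ _ _      = inj₁ b≤b
ordered-step false {p′ = false}        _ _ _      = inj₁ (≤-minimum _)
ordered-step true  {p′ = false} {true} b≤b f≤t _  = inj₂ (refl , refl , f≤t)
ordered-step true  {p′ = false} {true} b≤b b≤b ()
ordered-step true  {p′ = true}         _ _ _      = inj₁ (≤-maximum _)
ordered-step true  {p′ = false} {false} _ _ _     = inj₁ b≤b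

xor-involutive : ∀ s m → s xor (s xor m) ≡ m
xor-involutive false m = refl
xor-involutive true  m = not-involutive m

remode : Bool → Phase → Phase
remode s idle       = idle
remode s (active m) = active (s xor m)
remode s (done m)   = done (s xor m)

remode-involutive : ∀ s w → remode s (remode s w) ≡ w
remode-involutive s idle       = refl
remode-involutive s (active m) = cong active (xor-involutive s m)
remode-involutive s (done m)   = cong done (xor-involutive s m)

remode-collapse : ∀ s e w → remode s (collapse e w) ≡ collapse e (remode s w)
remode-collapse s ∗         w          =
  trans (cong (remode s) (collapse-∗ w)) (sym (collapse-∗ (remode s w)))
remode-collapse s (just 0F) idle       = refl
remode-collapse s (just 0F) (active _) = refl
remode-collapse s (just 0F) (done _)   = refl
remode-collapse s (just 1F) idle       = refl
remode-collapse s (just 1F) (active _) = refl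
remode-collapse s (just 1F) (done _)   = refl

remodeC : Bool → Vec Phase 3 → Vec Phase 3
remodeC s (x ∷ y ∷ z ∷ []) = x ∷ y ∷ remode s z ∷ []

remodeC-involutive : ∀ s ps → remodeC s (remodeC s ps) ≡ ps
remodeC-involutive s (x ∷ y ∷ z ∷ []) = cong (λ z → x ∷ y ∷ z ∷ []) (remode-involutive s z)

remodeC-collapse : ∀ s (e : Fin 3 → Maybe (Fin 2)) ps →
  remodeC s (tabulate λ u → collapse (e u) (lookup ps u)) ≡
  tabulate λ u → collapse (e u) (lookup (remodeC s ps) u)
remodeC-collapse s e (x ∷ y ∷ z ∷ []) = cong (λ z → _ ∷ _ ∷ z ∷ []) (remode-collapse s (e 2F) z)

isActive-remodeC : ∀ s ps u → isActive (lookup (remodeC s ps) u) ≡ isActive (lookup ps u)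
isActive-remodeC s (x ∷ y ∷ z ∷ []) 0F = refl
isActive-remodeC s (x ∷ y ∷ z ∷ []) 1F = refl
isActive-remodeC s (x ∷ y ∷ idle ∷ []) 2F = refl
isActive-remodeC s (x ∷ y ∷ active _ ∷ []) 2F = refl
isActive-remodeC s (x ∷ y ∷ done _ ∷ []) 2F = refl

OrderedAt : Bool → Vec Phase 3 → Set
OrderedAt s ps = Ordered s (isDone (lookup ps 0F)) (isDone (lookup ps 1F))

remodeC-ordered : ∀ s ps → OrderedAt s ps → OrderedAt s (remodeC s ps)
remodeC-ordered s (_ ∷ _ ∷ _ ∷ []) o = o

-- The flag s tells whether the two modes of c are interchanged.
Agree : (K K′ : Rule) → Set
Agree K K′ = ∀ s m p q → Ordered s p q → T (K m p q) → T (K′ (s xor m) p q)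

-- Forces c to be idle until a or b is done, which leaves the flag s free up to that moment.
Strict : Rule → Set
Strict K = ∀ m → ¬ T (K m false false)

permits-remodeC : ∀ {K K′} → Agree K K′ → ∀ s ps → OrderedAt s ps →
                  T (permits K ps) → T (permits K′ (remodeC s ps))
permits-remodeC agree s (x ∷ y ∷ idle ∷ [])     o p = _
permits-remodeC agree s (x ∷ y ∷ active m ∷ []) o p = agree s m (isDone x) (isDone y) o p
permits-remodeC agree s (x ∷ y ∷ done m ∷ [])   o p = agree s m (isDone x) (isDone y) o p

remodeC-invariant : ∀ {K} → Strict K → ∀ ps → .(T (permits K ps)) →
  isDone (lookup ps 0F) ≡ false → isDone (lookup ps 1F) ≡ false →
  ∀ s s′ → remodeC s ps ≡ remodeC s′ ps
remodeC-invariant strict (x ∷ y ∷ idle ∷ [])     _ _ _ s s′ = refl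
remodeC-invariant strict (x ∷ y ∷ active m ∷ []) p a b s s′ rewrite a | b =
  contradiction (recompute (T? _) p) (strict m)
remodeC-invariant strict (x ∷ y ∷ done m ∷ [])   p a b s s′ rewrite a | b =
  contradiction (recompute (T? _) p) (strict m)

-- Lets one lemma on replacements serve both directions of subsumption.
Replace-flip : ∀ {Act} {X : HDA Act} {S : Code → Code → Code → Code → Set} {ℓ x} {α β : Path X x} →
               Replace S ℓ α β → Replace (λ c₁ c₂ c₃ c₄ → S c₃ c₄ c₁ c₂) ℓ β α
Replace-flip (here S-αβ) = here S-αβ
Replace-flip (there ρ)   = there (Replace-flip ρ)

-- Matched cells and related paths

data Match {Act : Set} (L : Vec Act 3) (K K′ : Rule) (s : Bool) :
           ∃ (Face L (permits K)) → ∃ (Face L (permits K′)) → Set where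
  match : ∀ {U F G} → events G ≡ events F → phases G ≡ remodeC s (phases F) →
          OrderedAt s (phases F) → Match L K K′ s (U , F) (U , G)

module Matching {Act : Set} (L : Vec Act 3) {K K′} (mono : Monotone K) (mono′ : Monotone K′) where

  Y Z : HDA Act
  Y = model L K mono
  Z = model L K′ mono′

  match-initial : ∀ s → Match L K K′ s (_ , HDA.initial Y) (_ , HDA.initial Z)
  match-initial s = match refl refl (ordered-diagonal s)

  -- Renaming commutes with collapsing, and a cell is determined by its events and phases.
  match-δ : ∀ {s k n V} (i : Fin (suc n))
            {F : Face L (permits K) (suc n , V)} {G : Face L (permits K′) (suc n , V)}
            {F′ : Face L (permits K) (n , removeAt V i)} {G′ : Face L (permits K′) (n , removeAt V i)} →
            F′ ≡ HDA.δ Y k i F →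
            events G ≡ events F → phases G ≡ remodeC s (phases F) →
            events G′ ≡ events F′ → phases G′ ≡ remodeC s (phases F′) →
            G′ ≡ HDA.δ Z k i G
  match-δ {s} {k} {V = V} i {F} {G} refl eqE eqP eqE′ eqP′ = face-≡
    (trans eqE′ (cong (λ es → tabulate (lookup es ∘ punchIn i)) (sym eqE)))
    (trans eqP′ (trans (remodeC-collapse s (pull (events F) (Hom.ε (coface k {V} i))) (phases F))
      (cong₂ (λ es ps → tabulate λ u → collapse (pull es (Hom.ε (coface k {V} i)) u) (lookup ps u))
             (sym eqE) (sym eqP))))

  transport : ∀ {s x y x̂ ŷ} (t : Step Y x y) → Match L K K′ s x x̂ → Match L K K′ s y ŷ →
              ∃[ t̂ ] code {X = Y} {x} {y} t ≡ code {X = Z} {x̂} {ŷ} t̂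
  transport {s} (up {V = V} i refl)   (match eqE′ eqP′ _) (match {F = F} {G} eqE eqP _) =
    up i (cong (_ ,_) (match-δ {s} {V = V} i {F} {G} refl eqE eqP eqE′ eqP′)) , refl
  transport {s} (down {U = V} i refl) (match {F = F} {G} eqE eqP _) (match eqE′ eqP′ _) =
    down i (cong (_ ,_) (match-δ {s} {V = V} i {F} {G} refl eqE eqP eqE′ eqP′)) , refl

  -- One flag s serves all cells of a path: the renaming may not change along the way.
  data Related (s : Bool) : PathRel Y Z where
    []   : Related s [] []
    _▷_ : ∀ {x y x̂ ŷ} {α : Path Y x} {β : Path Z x̂} {t : Step Y x y} {t̂ : Step Z x̂ ŷ} →
          Related s α β → Match L K K′ s y ŷ × code t ≡ code t̂ → Related s (α ▷ t) (β ▷ t̂)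

  related-end : ∀ {s x x̂} {α : Path Y x} {β : Path Z x̂} → Related s α β → Match L K K′ s x x̂
  related-end []            = match-initial _
  related-end (_ ▷ (m , _)) = m

  related-length : ∀ {s x x̂} {α : Path Y x} {β : Path Z x̂} → Related s α β → length α ≡ length β
  related-length []      = refl
  related-length (r ▷ _) = cong suc (related-length r)

  -- `start` reads only codes of steps and lengths of prefixes, which related paths share.
  start-related : ∀ {s n U} {x : HDA.Ob Y (n , U)} {x̂ : HDA.Ob Z (n , U)}
                  {α : Path Y (_ , x)} {β : Path Z (_ , x̂)} →
                  Related s α β → ∀ c → start α c ≡ start β c
  start-related [] ()
  start-related (_▷_ {t = up i _} {up j _} r (match _ _ _ , eq)) c
    with match _ _ _ ← related-end r | refl ← toℕ-injective (d⁰-injective eq) with i ≟ c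
  ... | yes _   = cong suc (related-length r)
  ... | no  i≢c = start-related r (punchOut i≢c)
  start-related (_▷_ {t = down i _} {down j _} r (match _ _ _ , eq)) c
    with match _ _ _ ← related-end r | refl ← toℕ-injective (d¹-injective eq) =
    start-related r (punchIn i c)

  ST-related : ∀ {s x x̂} {α : Path Y x} {β : Path Z x̂} → Related s α β → ST α ≡ ST β
  ST-related [] = refl
  ST-related (_▷_ {t = up {V = V} i _} {up j _} r (match _ _ _ , eq))
    with refl ← toℕ-injective (d⁰-injective eq) = cong (_∷ʳ (lookup V i ⁺)) (ST-related r)
  ST-related (_▷_ {t = down {U = U} i _} {down j _} r (match _ _ _ , eq))
    with match _ _ _ ← related-end r | refl ← toℕ-injective (d¹-injective eq) =
    cong₂ (λ τ k → τ ∷ʳ (lookup U i at k)) (ST-related r) (start-related r i)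

  -- Related paths form a simulation

  module _ (agree : Agree K K′) (strict : Strict K) where

    remodeFace : ∀ s {U} (F : Face L (permits K) U) → OrderedAt s (phases F) → Face L (permits K′) U
    remodeFace s F o .events    = events F
    remodeFace s F o .phases    = remodeC s (phases F)
    remodeFace s (face _ _ inj _ _ _) o .injective = inj
    remodeFace s (face _ _ _ lab _ _) o .labels    = lab
    remodeFace s (face es ps _ _ act _) o .active-at t =
      subst T (sym (isActive-remodeC s ps (lookup es t))) (act t)
    remodeFace s (face _ ps _ _ _ all) o .allowed  = permits-remodeC agree s ps o all

    match-remode : ∀ s {x : HDA.Cell Y} (o : OrderedAt s (cellPhases x)) →
                   Match L K K′ s x (_ , remodeFace s (proj₂ x) o)
    match-remode s o = match refl refl o

    -- While neither a nor b is done, c is idle and renaming its modes does nothing.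
    switch : ∀ {s x x̂} {α : Path Y x} {β : Path Z x̂} s′ →
             (∀ {u} → u ≡ 0F ⊎ u ≡ 1F → isDone (lookup (cellPhases x) u) ≡ false) →
             Related s α β → Related s′ α β
    switch s′ nd [] = []
    switch {s} s′ nd (_▷_ {x} {_ , F@(face _ _ _ _ _ all)} {t = t} r (match eqE eqP o , eq)) =
      switch s′ nd₀ r ▷ (match eqE (trans eqP same) o′ , eq)
      where
      nd₀ : ∀ {u} → u ≡ 0F ⊎ u ≡ 1F → isDone (lookup (cellPhases x) u) ≡ false
      -- Done events stay done, so what is not done at the end of the step was not done before it.
      nd₀ {u} p = ≤-antisym
        (subst (_ ≤_) (nd p) (step-isDone L (permits-closed mono) _ t u)) (≤-minimum _)
      same = remodeC-invariant strict (phases F) all (nd (inj₁ refl)) (nd (inj₂ refl)) s s′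
      o′ : OrderedAt s′ (phases F)
      o′ rewrite nd (inj₁ refl) | nd (inj₂ refl) = ordered-diagonal s′

    -- If the new cell respects the direction s, the flag is kept. Otherwise neither a nor b was
    -- done before the step, and `switch` relates the same two paths with the flag `not s`.
    extend-related : ∀ {s x x̂ y} {α : Path Y x} {β : Path Z x̂} → Related s α β → (t : Step Y x y) →
                     ∃₂ λ s′ ŷ → ∃[ t̂ ] Related s′ (α ▷ t) (_▷_ {y = ŷ} β t̂)
    extend-related {s} r t with related-end r
    ... | m@(match _ _ o)
      with ordered-step s (step-isDone L (permits-closed mono) _ t 0F)
                          (step-isDone L (permits-closed mono) _ t 1F) o
    ...   | inj₁ o′ = let t̂ , eq = transport t m (match-remode s o′) in
                      s , _ , t̂ , r ▷ (match-remode s o′ , eq)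
    ...   | inj₂ (p , q , o′) =
      let r′     = switch (not s) (λ { (inj₁ refl) → p ; (inj₂ refl) → q }) r
          t̂ , eq = transport t (related-end r′) (match-remode (not s) o′)
      in not s , _ , t̂ , r′ ▷ (match-remode (not s) o′ , eq)

    up-ordered : ∀ {x y} s (t : Step Y x y) → IsUp (code {X = Y} t) →
                 OrderedAt s (cellPhases x) ≡ OrderedAt s (cellPhases y)
    up-ordered s t i = cong₂ (Ordered s) (up-isDone L (permits-closed mono) _ t i 0F)
                                         (up-isDone L (permits-closed mono) _ t i 1F)

    -- An up-step changes nothing about what is done, so the middle cell inherits the order from the
    -- neighbour across it. Two down-steps, as in a similarity, give no such neighbour.
    middle-ordered : ∀ {s w x y} (t₁ : Step Y w x) (t₂ : Step Y x y) →
                     IsUp (code {X = Y} t₁) ⊎ IsUp (code {X = Y} t₂) →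
                     OrderedAt s (cellPhases w) → OrderedAt s (cellPhases y) →
                     OrderedAt s (cellPhases x)
    middle-ordered {s} t₁ _ (inj₁ i) o _ = subst id (up-ordered s t₁ i) o
    middle-ordered {s} _ t₂ (inj₂ i) _ o = subst id (sym (up-ordered s t₂ i)) o

    replace-related : ∀ {S : Code → Code → Code → Code → Set} →
                      (∀ {c₁ c₂ c₃ c₄} → S c₁ c₂ c₃ c₄ → IsUp c₃ ⊎ IsUp c₄) →
                      ∀ {s ℓ x x̂} {α α′ : Path Y x} {β : Path Z x̂} → Related s α β →
                      Replace S ℓ α α′ → ∃[ β′ ] Replace S ℓ β β′ × Related s α′ β′
    replace-related {S} isUp′ {s} (r ▷ (m₁ , eq₁) ▷ (m₂ , eq₂)) (here {t₁ = t₁} {t₂} S-αα′)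
      with related-end r | m₂
    ... | m₀@(match _ _ o₀) | match _ _ o₂ =
      let o        = middle-ordered {s} t₁ t₂ (isUp′ S-αα′) o₀ o₂
          t̂₁ , eq₁′ = transport t₁ m₀ (match-remode s o)
          t̂₂ , eq₂′ = transport t₂ (match-remode s o) m₂
      in _ ▷ t̂₁ ▷ t̂₂
       -- The position of the replacement is counted by the prefix before it, whose length is the
       -- same in both paths.
       , subst (λ l → Replace S (suc l) _ (_ ▷ t̂₁ ▷ t̂₂)) (sym (related-length r))
           (here (subst₂ (λ c₁ c₂ → S c₁ c₂ _ _) eq₁ eq₂ (subst₂ (S _ _) eq₁′ eq₂′ S-αα′)))
       , r ▷ (match-remode s o , eq₁′) ▷ (m₂ , eq₂′)
    replace-related isUp′ (r ▷ me) (there ρ) =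
      let β′ , ρ̂ , r′ = replace-related isUp′ r ρ in _ , there ρ̂ , r′ ▷ me

    simulation : IsSimulation (｛ ⊑ ｝ ∪ ｛ ⊒ ｝ ∪ ｛ ↩ ｝) {Y} {Z} (λ α β → ∃[ s ] Related s α β)
    simulation = record
      { empty  = false , []
      ; trace  = λ (_ , r) → ST-related r
      ; extend = extend
      -- The up-step required among the two new steps is the first one when passing to a subsuming
      -- path, and the second one when passing to a subsumed path.
      ; sim-⊑  = λ _ (s , r) ρ →
          let β′ , ρ̂ , r′ = replace-related (inj₁ ∘ proj₁ ∘ sub-shape) r (Replace-flip ρ)
          in β′ , Replace-flip ρ̂ , s , r′
      ; sim-⊒  = λ _ (s , r) ρ →
          let β′ , ρ̂ , r′ = replace-related (inj₂ ∘ proj₂ ∘ proj₂ ∘ sub-shape) r ρ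
          in β′ , ρ̂ , s , r′
      ; sim-⇆  = λ { (inj₁ ()) ; (inj₂ (inj₁ ())) ; (inj₂ (inj₂ ())) }
      ; sim-↩  = λ _ (s , r) p → retract r p
      }
      where
      extend : ∀ {y z} {α : Path Y y} {β : Path Z z} → (∃[ s ] Related s α β) →
               ∀ {y′} {α′ : Path Y y′} → α ↪ α′ →
               ∃₂ λ z′ (β′ : Path Z z′) → β ↪ β′ × (∃[ s ] Related s α′ β′)
      extend (s , r) ↪-refl = _ , _ , ↪-refl , s , r
      extend r (↪-step {s = t} p) =
        let _ , β′ , q , s , r′ = extend r p
            s′ , _ , _ , r″     = extend-related r′ t
        in _ , _ , ↪-step q , s′ , r″

      retract : ∀ {s y z} {α : Path Y y} {β : Path Z z} → Related s α β →
                ∀ {y′} {α′ : Path Y y′} → α′ ↪ α →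
                ∃₂ λ z′ (β′ : Path Z z′) → β′ ↪ β × (∃[ s ] Related s α′ β′)
      retract r       ↪-refl     = _ , _ , ↪-refl , _ , r
      retract (r ▷ _) (↪-step p) = let _ , β′ , q , r′ = retract r p in _ , β′ , ↪-step q , r′

-- Symmetry of the relation and bisimilarity of the models

match-sym : ∀ {Act} {L : Vec Act 3} {K K′ s x y} → Match L K K′ s x y → Match L K′ K s y x
match-sym {s = s} (match {F = F} eqE eqP o) = match (sym eqE)
  (trans (sym (remodeC-involutive s (phases F))) (cong (remodeC s) (sym eqP)))
  (subst (OrderedAt s) (sym eqP) (remodeC-ordered s (phases F) o))

module _ {Act : Set} (L : Vec Act 3) {K K′} (mono : Monotone K) (mono′ : Monotone K′) where

  private
    module M  = Matching L mono mono′
    module M′ = Matching L mono′ mono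

  related-sym : ∀ {s x y} {α : Path (model L K mono) x} {β : Path (model L K′ mono′) y} →
                M.Related s α β → M′.Related s β α
  related-sym M.[] = M′.[]
  related-sym (r M.▷ (m , eq)) = related-sym r M′.▷ (match-sym m , sym eq)

module _ {Act : Set} (L : Vec Act 3) {K K′} (mono : Monotone K) (mono′ : Monotone K′) where

  -- Renaming is an involution, so the converse of the relation is the relation for the exchanged
  -- rules, and one simulation lemma covers both halves.
  model-bisimilar : Agree K K′ → Agree K′ K → Strict K → Strict K′ →
                    Bisimilar (｛ ⊑ ｝ ∪ ｛ ⊒ ｝ ∪ ｛ ↩ ｝) (model L K mono) (model L K′ mono′)
  model-bisimilar agree agree′ strict strict′ =
    (λ α β → ∃[ s ] Matching.Related L mono mono′ s α β) ,
    Matching.simulation L mono mono′ agree strict ,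
    IsSimulation-resp (λ (s , r) → s , related-sym L mono′ mono r)
                      (λ (s , r) → s , related-sym L mono mono′ r)
      (Matching.simulation L mono′ mono agree′ strict′)

-- Reading phases off ST-traces

length-ST : ∀ {Act} {X : HDA Act} {x} (α : Path X x) → List.length (ST α) ≡ length α
length-ST []             = refl
length-ST (α ▷ up _ _)   = trans (length-++ (ST α)) (trans (+-comm _ 1) (cong suc (length-ST α)))
length-ST (α ▷ down _ _) = trans (length-++ (ST α)) (trans (+-comm _ 1) (cong suc (length-ST α)))

-- Used to see that a replacement at the last inner cell concerns the last two steps.
Replace-< : ∀ {Act} {X : HDA Act} {S ℓ x} {α β : Path X x} → Replace S ℓ α β → ℓ < length β
Replace-< (here _)  = s≤s (s≤s ≤-refl)
Replace-< (there ρ) = m<n⇒m<1+n (Replace-< ρ)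

ST-init : ∀ {Act} {X : HDA Act} {x y} {α : Path X x} {τ e} (t : Step X x y) →
          ST (α ▷ t) ≡ τ ∷ʳ e → ST α ≡ τ
ST-init {α = α} {τ} (up _ _)   eq = ∷ʳ-injectiveˡ (ST α) τ eq
ST-init {α = α} {τ} (down _ _) eq = ∷ʳ-injectiveˡ (ST α) τ eq

module _ {Act : Set} {N} (L : Vec Act N) {P : Vec Phase N → Bool}
         (closed : Closed P) (start-allowed : T (P (replicate N idle)))
         (L-injective : Injective _≡_ _≡_ (lookup L)) where

  private
    X = complexHDA L closed start-allowed

    phaseAt : ∃ (Face L P) → Fin N → Phase
    phaseAt x = lookup (cellPhases x)

    at-injective : ∀ {a b : Act} {k l} → a at k ≡ b at l → a ≡ b
    at-injective refl = refl

    ⁺-injective : ∀ {a b : Act} → a ⁺ ≡ b ⁺ → a ≡ b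
    ⁺-injective refl = refl

  -- Labels are distinct, so a label identifies the event, and listed events are active.
  active-event : ∀ {U} (F : Face L P U) t p → lookup (proj₂ U) t ≡ lookup L p →
                 ∃[ m ] lookup (phases F) p ≡ active m
  active-event (face es ps _ lab act _) t p eq
    with refl ← recompute (_ ≟ p) (L-injective (trans (lab t) eq))
    with lookup ps (lookup es t) | recompute (T? _) (act t)
  ... | active m | _ = m , refl

  down-active : ∀ {w x τ k} {γ : Path X w} (t : Step X w x) p →
                ST (γ ▷ t) ≡ τ ∷ʳ (lookup L p at k) → ∃[ m ] phaseAt w p ≡ active m
  down-active {τ = τ} {γ = γ} (up _ _) p eq with () ← ∷ʳ-injectiveʳ (ST γ) τ eq
  down-active {τ = τ} {γ = γ} (down {x = F} i _) p eq =
    active-event F i p (at-injective (∷ʳ-injectiveʳ (ST γ) τ eq))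

  up-active : ∀ {w x τ} {γ : Path X w} (t : Step X w x) p →
              ST (γ ▷ t) ≡ τ ∷ʳ (lookup L p ⁺) → ∃[ m ] phaseAt x p ≡ active m
  up-active {τ = τ} {γ = γ} (up {y = F} i _) p eq =
    active-event F i p (⁺-injective (∷ʳ-injectiveʳ (ST γ) τ eq))
  up-active {τ = τ} {γ = γ} (down _ _) p eq with () ← ∷ʳ-injectiveʳ (ST γ) τ eq

  -- The trace shows p active before and q active after the last two steps of β. The cells there are
  -- faces of the middle cell of β′, so both events are active in it, and q has the mode that it has
  -- at the end of the path.
  exchange-cell : ∀ {ℓ y} {β β′ : Path X y} {τ k} p q → β ⊑[ ℓ ] β′ → suc ℓ ≡ length β →
    ST β ≡ τ ∷ʳ (lookup L p at k) ∷ʳ (lookup L q ⁺) →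
    ∃[ x ] ∃₂ λ m m′ → phaseAt x p ≡ active m
                     × phaseAt x q ≡ active m′
                     × phaseAt y q ≡ active m′
  exchange-cell {τ = τ} p q (here {x = x} {γ = γ} {s₁} {s₂} {t₁} {t₂} σ) _ eq
    with c₁ , c₂ , _ ← sub-shape σ
    with m , w≡ ← down-active {γ = γ} t₁ p (ST-init t₂ eq)
       | m′ , y≡ ← up-active {τ = τ ∷ʳ _} {γ = γ ▷ t₁} t₂ q eq
    = x , m , m′ , keeps-up s₁ c₁ p w≡ , keeps-down s₂ c₂ q y≡ , y≡
    where
    keeps-up : ∀ {x y} (s : Step X x y) → IsUp (code {X = X} s) → ∀ u {m} →
               phaseAt x u ≡ active m → phaseAt y u ≡ active m
    keeps-up (up {y = F} i refl) _ u = δ-active L closed start-allowed 0F i F u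
    keeps-up (down _ _) ()

    keeps-down : ∀ {x y} (s : Step X x y) → IsDown (code {X = X} s) → ∀ u {m} →
                 phaseAt y u ≡ active m → phaseAt x u ≡ active m
    keeps-down (down {x = F} i refl) _ u = δ-active L closed start-allowed 1F i F u
    keeps-down (up _ _) ()
  exchange-cell p q (there ρ) eq _ = contradiction (Replace-< ρ) (<-irrefl (suc-injective eq))

-- The two rules

K∧∨ K-proj : Rule
K∧∨ m p q = if m then p ∨ q else p ∧ q
K-proj m p q = if m then q else p

K∧∨-monotone : Monotone K∧∨
K∧∨-monotone true  f≤t             _   _ = _
K∧∨-monotone true  (b≤b {true})    _   _ = _
K∧∨-monotone true  (b≤b {false})   f≤t ()
K∧∨-monotone true  (b≤b {false})   b≤b t = t
K∧∨-monotone false (b≤b {true})    f≤t _ = _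
K∧∨-monotone false (b≤b {true})    b≤b t = t

K-proj-monotone : Monotone K-proj
K-proj-monotone true  _   f≤t _ = _
K-proj-monotone true  _   b≤b t = t
K-proj-monotone false f≤t _   _ = _
K-proj-monotone false b≤b _   t = t

-- If p ≤ q, then p ∧ q is p and p ∨ q is q; if q ≤ p, the projections are exchanged, as are the
-- modes.
agree : Agree K∧∨ K-proj
agree false false true  true b≤b _ = _
agree false true  true  true b≤b _ = _
agree false true  false _    _   t = t
agree true  false true  true b≤b _ = _
agree true  true  true  _    _   _ = _
agree true  true  false _    b≤b t = t

agree′ : Agree K-proj K∧∨
agree′ false false true  true b≤b _ = _
agree′ false true  true  true _   _ = _
agree′ false true  false true _   _ = _
agree′ true  false true  _    _   _ = _
agree′ true  true  true  true _   _ = _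

strict∧∨ : Strict K∧∨
strict∧∨ true  ()
strict∧∨ false ()

strict-proj : Strict K-proj
strict-proj true  ()
strict-proj false ()

-- Failure of qhp-bisimilarity

module _ {Act : Set} {a b c : Act} (a≢b : a ≢ b) (a≢c : a ≢ c) (b≢c : b ≢ c) where

  L : Vec Act 3
  L = a ∷ b ∷ c ∷ []

  L-injective : Injective _≡_ _≡_ (lookup L)
  L-injective = lookup-injective ((a≢b ∷ a≢c ∷ []) ∷ (b≢c ∷ []) ∷ [] ∷ []) _ _

  Y Z : HDA Act
  Y = model L K∧∨ K∧∨-monotone
  Z = model L K-proj K-proj-monotone

  open HDA Y using (Ob; δ)

  ab : Ob (2 , a ∷ b ∷ [])
  ab = face (0F ∷ 1F ∷ []) (active false ∷ active false ∷ idle ∷ [])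
    (lookup-injective (((λ ()) ∷ []) ∷ [] ∷ []) _ _) (λ { 0F → refl ; 1F → refl }) (λ { 0F → _ ; 1F → _ }) _

  -- Only mode `true` lets c run in Y while one of a and b is done and the other active.
  ac : Ob (2 , a ∷ c ∷ [])
  ac = face (0F ∷ 2F ∷ []) (active false ∷ done false ∷ active true ∷ [])
    (lookup-injective (((λ ()) ∷ []) ∷ [] ∷ []) _ _) (λ { 0F → refl ; 1F → refl }) (λ { 0F → _ ; 1F → _ }) _

  bc : Ob (2 , b ∷ c ∷ [])
  bc = face (1F ∷ 2F ∷ []) (done false ∷ active false ∷ active true ∷ [])
    (lookup-injective (((λ ()) ∷ []) ∷ [] ∷ []) _ _) (λ { 0F → refl ; 1F → refl }) (λ { 0F → _ ; 1F → _ }) _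

  -- This is also the face of `ac` in which a ends: the two squares share the edge of c, so the
  -- paths below have a common end.
  edge : Ob (1 , c ∷ [])
  edge = δ 1F 0F bc

  αab : Path Y (_ , ab)
  αab = [] ▷ up {y = δ 0F 1F ab} 0F refl ▷ up 1F refl

  -- The superscript is the event that ends first; the other one overlaps with c
  -- in the primed path.
  αᵃ αᵃ′ αᵇ αᵇ′ : Path Y (_ , edge)
  αᵃ  = αab ▷ down {y = δ 1F 0F ab} 0F refl ▷ down {y = δ 0F 0F edge} 0F refl ▷ up 0F refl
  αᵃ′ = αab ▷ down {y = δ 1F 0F ab} 0F refl ▷ up {y = bc} 1F refl ▷ down 0F refl
  αᵇ  = αab ▷ down {y = δ 1F 1F ab} 1F refl ▷ down {y = δ 0F 0F edge} 0F refl ▷ up 0F refl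
  αᵇ′ = αab ▷ down {y = δ 1F 1F ab} 1F refl ▷ up {y = ac} 1F refl ▷ down 0F refl

  αᵃ⊑αᵃ′ : αᵃ ⊑[ 4 ] αᵃ′
  αᵃ⊑αᵃ′ = here (sub¹⁰ (s≤s z≤n))

  αᵇ⊑αᵇ′ : αᵇ ⊑[ 4 ] αᵇ′
  αᵇ⊑αᵇ′ = here (sub¹⁰ (s≤s z≤n))

  αᵇ⇆αᵃ : αᵇ ⇆[ 3 ] αᵃ
  αᵇ⇆αᵃ = inj₁ (there (here (sim¹¹ (s≤s z≤n))))

  []↪αᵃ : ([] {X = Y}) ↪ αᵃ
  []↪αᵃ = ↪-step (↪-step (↪-step (↪-step (↪-step ↪-refl))))

  -- Both paths end in `y`, so one mode of c in Z would have to overlap with b and also with a.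
  ¬exchange-both : ∀ {y} {β β₁ β′ β′₁ : Path Z y} → ST β ≡ ST αᵃ → β ⊑[ 4 ] β₁ →
                   ST β′ ≡ ST αᵇ → β′ ⊑[ 4 ] β′₁ → ⊥
  ¬exchange-both {β = β} {β′ = β′} eq ρ eq′ ρ′
    -- The traces have five entries, the last two being the end of b, respectively a, and the start
    -- of c.
    with exchange-cell L (permits-closed K-proj-monotone) _ L-injective {τ = _ ∷ _ ∷ _ ∷ []}
           1F 2F ρ
           (sym (trans (sym (length-ST β)) (cong List.length eq))) eq
       | exchange-cell L (permits-closed K-proj-monotone) _ L-injective {τ = _ ∷ _ ∷ _ ∷ []}
           0F 2F ρ′
           (sym (trans (sym (length-ST β′)) (cong List.length eq′))) eq′
  ... | (_ , face _ (_ ∷ _ ∷ _ ∷ []) _ _ _ all) , _ , m , refl , refl , y≡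
      | (_ , face _ (_ ∷ _ ∷ _ ∷ []) _ _ _ all′) , _ , m′ , refl , refl , y≡′
      -- The two modes of c coincide, being read at the same cell.
      with refl ← trans (sym y≡) y≡′ = absurd m all all′
      where
      -- In Z, mode `true` is barred while b is active, and mode `false` while a is.
      absurd : ∀ m {p q} → .(T (K-proj m p false)) → .(T (K-proj m false q)) → ⊥
      absurd true  () _
      absurd false _ ()

  ¬qhp-bisimilar : ¬ Bisimilar qhp Y Z
  ¬qhp-bisimilar (R , S , _) =
    let open IsSimulation S
        _ , _ , _ , r  = extend empty []↪αᵃ
        _ , ρ , _      = sim-⊑ (inj₁ refl) r αᵃ⊑αᵃ′
        -- Similarity fixes the end cell, so the answer to `αᵇ` ends where the answer to `αᵃ` does.
        _ , _ , r′     = sim-⇆ (inj₂ refl) r αᵇ⇆αᵃ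
        _ , ρ′ , _     = sim-⊑ (inj₁ refl) r′ αᵇ⊑αᵇ′
    in ¬exchange-both (sym (trace r)) ρ (sym (trace r′)) ρ′

theorem5p8 : (Act : Set) (a b c d : Act) → Unique (a ∷ b ∷ c ∷ d ∷ []) →
    (Bisimilar {Act} qhp ⇒ Bisimilar {Act} shp)
    × (∃₂ λ (Y Z : HDA Act) → Bisimilar shp Y Z × ¬ Bisimilar qhp Y Z)
    × (∃₂ λ (Y Z : HDA Act) → Bisimilar (｛ ⊑ ｝ ∪ ｛ ⊒ ｝ ∪ ｛ ↩ ｝) Y Z × ¬ Bisimilar qhp Y Z)
theorem5p8 Act a b c d ((a≢b ∷ a≢c ∷ _) ∷ (b≢c ∷ _) ∷ _) =
    Bisimilar-antitone inj₁
  , (_ , _ , Bisimilar-antitone inj₁ bisimilar , ¬qhp-bisimilar a≢b a≢c b≢c)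
  , (_ , _ , bisimilar , ¬qhp-bisimilar a≢b a≢c b≢c)
  where
  bisimilar = model-bisimilar (a ∷ b ∷ c ∷ []) K∧∨-monotone K-proj-monotone agree agree′ strict∧∨ strict-proj
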